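{- Let $G$ be a $2$-divisible $\ell u$-group with strong unit $u$, and let ${}^*$ be the unique function on $[id,u]$ with $g^*+g^*=u+g$ for all $g\in[id,u]$. Then $\Gamma(G,u,*)=([id,u],\oplus,\neg,id,\kappa)$, where for $x,y\in[id,u]$ $$x\oplus y:=u\wedge(x+y),\qquad \neg x:=u+(-x),\qquad \kappa x:=x^*,$$ is a continuous algebra.
   Context: An $\ell u$-group is a tuple $(G,+,-,id,\vee,\wedge,u)$ where $(G,+,-,id)$ is an abelian group, $(G,\vee,\wedge)$ is a lattice, $(x\vee y)+z=(x+z)\vee(y+z)$ for all $x,y,z\in G$, and $u$ is a strong unit: for all $x\in G$ there is a natural number $n$ with $|x|\le nu$ (where $|x|=x\vee -x$). It is $2$-divisible if for each $g\in G$ there is $h\in G$ with $g=h+h$. $[id,u]=\{g\in G: id\le g\le u\}$. A continuous algebra is a tuple $(A,\oplus,\neg,\bar 0,\kappa)$, where $\oplus$ is a binary operation on $A$, $\bar 0\in A$, and $\neg,\kappa$ are unary operations on $A$, such that for all $x,y,z\in A$: (C1) $x\oplus(y\oplus z)=(x\oplus y)\oplus z$; (C2) $x\oplus y=y\oplus x$; (C3) $x\oplus\bar 0=x$; (C4) $\neg\neg x=x$; (C5) $x\oplus\neg\bar 0=\neg\bar 0$; (C6) $\neg(\neg x\oplus y)\oplus y=\neg(\neg y\oplus x)\oplus x$; (C7) $\kappa x=x\oplus\neg\kappa x$; (C8) $(\neg\kappa x\oplus\kappa y)\oplus\neg(\neg x\oplus y)=\neg\bar 0$. -}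

module Defs where

open import Level using (Level; suc; _⊔_)
open import Algebra.Core using (Op₁; Op₂)
open import Algebra.Bundles using (AbelianGroup)
open import Algebra.Structures using (IsAbelianGroup)
import Algebra.Definitions
import Algebra.Definitions.RawMonoid as RawMonoidDefinitions
import Algebra.Properties.AbelianGroup as AbelianGroupProperties
open import Algebra.Lattice.Bundles using (Lattice)
open import Algebra.Lattice.Structures using (IsLattice)
import Algebra.Lattice.Properties.Lattice as LatticeProperties
open import Data.Nat.Base as ℕ using (ℕ)
open import Data.Product using (Σ; ∃; _×_; _,_; proj₁; proj₂)
open import Relation.Binary.Core using (Rel)
open import Relation.Binary.Bundles using (Poset)
open import Relation.Binary.Structures using (IsEquivalence)
import Relation.Binary.Lattice.Structures as OrderLattice
import Relation.Binary.Reasoning.PartialOrder as PosetReasoning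

record LuGroup (c ℓ : Level) : Set (suc (c ⊔ ℓ)) where
  infix  4 _≈_
  infixl 6 _+_
  infixr 6 _∨_
  infixr 7 _∧_
  infix  8 -_
  field
    Carrier        : Set c
    _≈_            : Rel Carrier ℓ
    _+_            : Op₂ Carrier
    -_             : Op₁ Carrier
    id             : Carrier
    _∨_            : Op₂ Carrier
    _∧_            : Op₂ Carrier
    u              : Carrier
    isAbelianGroup : IsAbelianGroup _≈_ _+_ id -_
    isLattice      : IsLattice _≈_ _∨_ _∧_
    +-distribʳ-∨   : ∀ x y z → (x ∨ y) + z ≈ (x + z) ∨ (y + z)

  abelianGroup : AbelianGroup c ℓ
  abelianGroup = record { isAbelianGroup = isAbelianGroup }

  lattice : Lattice c ℓ
  lattice = record { isLattice = isLattice }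

  -- The lattice order: x ≤ y unfolds to x ≈ x ∧ y.
  poset : Poset c ℓ ℓ
  poset = LatticeProperties.poset lattice

  open Poset poset public using (_≤_)

  -- n · x is the n-fold sum x + ⋯ + x, with 0 · x = id.
  open RawMonoidDefinitions (AbelianGroup.rawMonoid abelianGroup) public
    using () renaming (_×_ to _·_)

  ∣_∣ : Op₁ Carrier
  ∣ x ∣ = x ∨ (- x)

  field
    strongUnit : ∀ x → ∃ λ (n : ℕ) → ∣ x ∣ ≤ n · u

  [id,u] : Set (c ⊔ ℓ)
  [id,u] = Σ Carrier λ g → id ≤ g × g ≤ u

  infix 4 _≈ᵢ_
  _≈ᵢ_ : Rel [id,u] ℓ
  x ≈ᵢ y = proj₁ x ≈ proj₁ y

TwoDivisible : ∀ {c ℓ} → LuGroup c ℓ → Set (c ⊔ ℓ)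
TwoDivisible G = ∀ g → ∃ λ h → g ≈ h + h
  where open LuGroup G

IsStar : ∀ {c ℓ} (G : LuGroup c ℓ) → Op₁ (LuGroup.[id,u] G) → Set (c ⊔ ℓ)
IsStar G _* = ∀ g → proj₁ (g *) + proj₁ (g *) ≈ u + proj₁ g
  where open LuGroup G

PointwiseEq : ∀ {c ℓ} (G : LuGroup c ℓ) → Rel (Op₁ (LuGroup.[id,u] G)) (c ⊔ ℓ)
PointwiseEq G f g = ∀ x → f x ≈ᵢ g x
  where open LuGroup G

record RawContinuousAlgebra (c ℓ : Level) : Set (suc (c ⊔ ℓ)) where
  infix  4 _≈_
  infixl 6 _⊕_
  infix  8 ¬_
  field
    Carrier : Set c
    _≈_     : Rel Carrier ℓ
    _⊕_     : Op₂ Carrier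
    ¬_      : Op₁ Carrier
    0̄       : Carrier
    κ       : Op₁ Carrier

-- Over a setoid, being an algebra includes the operations respecting _≈_.
record IsContinuousAlgebra {c ℓ} (A : RawContinuousAlgebra c ℓ) : Set (c ⊔ ℓ) where
  open RawContinuousAlgebra A
  open Algebra.Definitions _≈_ using (Congruent₁; Congruent₂)
  field
    isEquivalence : IsEquivalence _≈_
    ⊕-cong        : Congruent₂ _⊕_
    ¬-cong        : Congruent₁ ¬_
    κ-cong        : Congruent₁ κ
    C1 : ∀ x y z → x ⊕ (y ⊕ z) ≈ (x ⊕ y) ⊕ z
    C2 : ∀ x y → x ⊕ y ≈ y ⊕ x
    C3 : ∀ x → x ⊕ 0̄ ≈ x
    C4 : ∀ x → ¬ (¬ x) ≈ x
    C5 : ∀ x → x ⊕ (¬ 0̄) ≈ ¬ 0̄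
    C6 : ∀ x y → ¬ ((¬ x) ⊕ y) ⊕ y ≈ ¬ ((¬ y) ⊕ x) ⊕ x
    C7 : ∀ x → κ x ≈ x ⊕ (¬ (κ x))
    C8 : ∀ x y → ((¬ (κ x)) ⊕ κ y) ⊕ (¬ ((¬ x) ⊕ y)) ≈ ¬ 0̄

module IntervalClosure {c ℓ} (G : LuGroup c ℓ) where
  open LuGroup G
  open AbelianGroup abelianGroup using (comm; identityˡ; identityʳ; inverseʳ; ∙-congʳ)
  open AbelianGroupProperties abelianGroup using (//-rightDividesˡ; //-rightDividesʳ)
  open OrderLattice.IsLattice (LatticeProperties.∨-∧-isOrderTheoreticLattice lattice) using (x≤x∨y; y≤x∨y; ∨-least; x∧y≤x; ∧-greatest)
  open Poset poset using (antisym) renaming (refl to ≤-refl; trans to ≤-trans)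
  open PosetReasoning poset

  +-monoˡ : ∀ z {x y} → x ≤ y → x + z ≤ y + z
  +-monoˡ z {x} {y} x≤y = begin
    x + z              ≤⟨ x≤x∨y _ _ ⟩
    (x + z) ∨ (y + z)  ≈⟨ +-distribʳ-∨ x y z ⟨
    (x ∨ y) + z        ≈⟨ ∙-congʳ (antisym (∨-least x≤y ≤-refl) (y≤x∨y x y)) ⟩
    y + z              ∎

  +-monoʳ : ∀ z {x y} → x ≤ y → z + x ≤ z + y
  +-monoʳ z {x} {y} x≤y = begin
    z + x  ≈⟨ comm z x ⟩
    x + z  ≤⟨ +-monoˡ z x≤y ⟩
    y + z  ≈⟨ comm y z ⟩
    z + y  ∎

  +-nonneg : ∀ {x y} → id ≤ x → id ≤ y → id ≤ x + y
  +-nonneg {x} {y} 0≤x 0≤y = begin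
    id      ≤⟨ 0≤y ⟩
    y       ≈⟨ identityˡ y ⟨
    id + y  ≤⟨ +-monoˡ y 0≤x ⟩
    x + y   ∎

  ≤+⇒-≤ : ∀ {x y z} → x ≤ y + z → x + (- z) ≤ y
  ≤+⇒-≤ {x} {y} {z} p = begin
    x + (- z)        ≤⟨ +-monoˡ (- z) p ⟩
    (y + z) + (- z)  ≈⟨ //-rightDividesʳ z y ⟩
    y                ∎

  -≤⇒≤+ : ∀ {x y z} → x + (- z) ≤ y → x ≤ y + z
  -≤⇒≤+ {x} {y} {z} p = begin
    x                ≈⟨ //-rightDividesˡ z x ⟨
    (x + (- z)) + z  ≤⟨ +-monoˡ z p ⟩
    y + z            ∎

  ≤⇒0≤- : ∀ {x y} → x ≤ y → id ≤ y + (- x)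
  ≤⇒0≤- {x} {y} p = begin
    id         ≈⟨ inverseʳ x ⟨
    x + (- x)  ≤⟨ +-monoˡ (- x) p ⟩
    y + (- x)  ∎

  -- The positive and negative parts of x are disjoint.
  disjoint : ∀ x {z} → z ≤ x ∨ id → z ≤ (- x) ∨ id → z ≤ id
  disjoint x {z} z≤x⁺ z≤x⁻ = begin
    z                              ≈⟨ //-rightDividesʳ x⁻ z ⟨
    (z + x⁻) + (- x⁻)              ≤⟨ ≤+⇒-≤ (begin
      z + x⁻                         ≈⟨ comm z x⁻ ⟩
      x⁻ + z                         ≈⟨ +-distribʳ-∨ (- x) id z ⟩
      ((- x) + z) ∨ (id + z)         ≤⟨ ∨-least -x+z≤x⁻ (begin
        id + z                         ≈⟨ identityˡ z ⟩
        z                              ≤⟨ z≤x⁻ ⟩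
        x⁻                             ∎) ⟩
      x⁻                             ≈⟨ identityˡ x⁻ ⟨
      id + x⁻                        ∎) ⟩
    id                             ∎
    where
    x⁻ = (- x) ∨ id
    -x+z≤x⁻ : (- x) + z ≤ x⁻
    -x+z≤x⁻ = begin
      (- x) + z                 ≈⟨ comm (- x) z ⟩
      z + (- x)                 ≤⟨ +-monoˡ (- x) z≤x⁺ ⟩
      (x ∨ id) + (- x)          ≈⟨ +-distribʳ-∨ x id (- x) ⟩
      (x + (- x)) ∨ (id + (- x)) ≤⟨ ∨-least
        (begin x + (- x) ≈⟨ inverseʳ x ⟩ id ≤⟨ y≤x∨y _ _ ⟩ x⁻ ∎)
        (begin id + (- x) ≈⟨ identityˡ (- x) ⟩ - x ≤⟨ x≤x∨y _ _ ⟩ x⁻ ∎) ⟩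
      x⁻                        ∎

  ·-nonneg : ∀ n {x} → id ≤ x → id ≤ n · x
  ·-nonneg ℕ.zero    0≤x = ≤-refl
  ·-nonneg (ℕ.suc n) 0≤x = +-nonneg 0≤x (·-nonneg n 0≤x)

  ·-mono : ∀ n {x y} → x ≤ y → n · x ≤ n · y
  ·-mono ℕ.zero    x≤y = ≤-refl
  ·-mono (ℕ.suc n) x≤y = ≤-trans (+-monoˡ _ x≤y) (+-monoʳ _ (·-mono n x≤y))

  disjoint-· : ∀ n x {z} → z ≤ n · (x ∨ id) → z ≤ (- x) ∨ id → z ≤ id
  disjoint-· ℕ.zero    x     p q = p
  disjoint-· (ℕ.suc n) x {z} p q = disjoint-· n x z≤nx⁺ q
    where
    nx⁺ = n · (x ∨ id)
    0≤nx⁺ : id ≤ nx⁺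
    0≤nx⁺ = ·-nonneg n (y≤x∨y x id)
    z-nx⁺≤id : z + (- nx⁺) ≤ id
    z-nx⁺≤id = disjoint x (≤+⇒-≤ p) (≤+⇒-≤ (begin
      z                    ≤⟨ q ⟩
      (- x) ∨ id           ≈⟨ identityʳ _ ⟨
      ((- x) ∨ id) + id    ≤⟨ +-monoʳ _ 0≤nx⁺ ⟩
      ((- x) ∨ id) + nx⁺   ∎))
    z≤nx⁺ : z ≤ nx⁺
    z≤nx⁺ = begin
      z         ≤⟨ -≤⇒≤+ z-nx⁺≤id ⟩
      id + nx⁺  ≈⟨ identityˡ nx⁺ ⟩
      nx⁺       ∎

  -- Not an axiom of strong units: it follows from ∣ u ∣ ≤ n · u.
  id≤u : id ≤ u
  id≤u with n , ∣u∣≤nu ← strongUnit u = begin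
    id           ≈⟨ inverseʳ u ⟨
    u + (- u)    ≤⟨ +-monoʳ u -u≤id ⟩
    u + id       ≈⟨ identityʳ u ⟩
    u            ∎
    where
    -u≤id : (- u) ≤ id
    -u≤id = disjoint-· n u
      (≤-trans (y≤x∨y u (- u)) (≤-trans ∣u∣≤nu (·-mono n (x≤x∨y u id))))
      (x≤x∨y (- u) id)

  ⊕-closed : ∀ {x y} → id ≤ x → id ≤ y → id ≤ u ∧ (x + y) × u ∧ (x + y) ≤ u
  ⊕-closed 0≤x 0≤y = ∧-greatest id≤u (+-nonneg 0≤x 0≤y) , x∧y≤x _ _

  ¬-closed : ∀ {x} → id ≤ x → x ≤ u → id ≤ u + (- x) × u + (- x) ≤ u
  ¬-closed {x} 0≤x x≤u = ≤⇒0≤- x≤u , ≤+⇒-≤ (begin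
    u       ≈⟨ identityʳ u ⟨
    u + id  ≤⟨ +-monoʳ u 0≤x ⟩
    u + x   ∎)

Γ : ∀ {c ℓ} (G : LuGroup c ℓ) → Op₁ (LuGroup.[id,u] G) → RawContinuousAlgebra (c ⊔ ℓ) ℓ
Γ G _* = record
  { Carrier = [id,u]
  ; _≈_     = _≈ᵢ_
  ; _⊕_     = λ (x , 0≤x , _) (y , 0≤y , _) → u ∧ (x + y) , ⊕-closed 0≤x 0≤y
  ; ¬_      = λ (x , 0≤x , x≤u) → u + (- x) , ¬-closed 0≤x x≤u
  ; 0̄       = id , Poset.refl poset , id≤u
  ; κ       = _*
  }
  where
  open LuGroup G
  open IntervalClosure G

{-# OPTIONS --safe #-}

-- In an ℓ-group, if id ≤ h + h then - h ≤ h, so the negative part of h lies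
-- below its positive part, and being disjoint from it must vanish.  Hence
-- h + h ≤ k + k implies h ≤ k, which gives the bounds of g*, its uniqueness and
-- congruence.  For (C6) one computes
-- ¬ (¬ x ⊕ y) + y ≈ x ∨ y.  With p = ¬ (¬ x ⊕ y) this also gives x ≤ p + y, so
-- x* + x* ≈ u + x ≤ (p + y*) + (p + y*), and halving yields x* ≤ p + y*,
-- which is (C8).
module Submission where

open import Defs
open import Level using (Level)
open import Algebra.Core using (Op₁)
open import Algebra.Bundles using (AbelianGroup)
open import Algebra.Lattice.Bundles using (Lattice)
import Algebra.Lattice.Properties.Lattice as LatticeProperties
import Algebra.Properties.AbelianGroup as AbelianGroupProperties
import Algebra.Properties.CommutativeSemigroup as CommutativeSemigroupProperties
open import Data.Product using (_×_; ∃!; _,_; proj₁; proj₂)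
open import Relation.Binary.Bundles using (Poset)
import Relation.Binary.Lattice.Structures as OrderLattice
import Relation.Binary.Reasoning.PartialOrder as PosetReasoning

module LuGroupProperties {c ℓ} (G : LuGroup c ℓ) where
  open LuGroup G
  open IntervalClosure G public
  open AbelianGroup abelianGroup public
    using (comm; assoc; identityˡ; identityʳ; inverseˡ; ∙-cong; ∙-congˡ; ∙-congʳ; ⁻¹-cong; refl; sym; trans)
  open AbelianGroupProperties abelianGroup public
    using (//-rightDividesˡ; //-rightDividesʳ; ε⁻¹≈ε)
  open CommutativeSemigroupProperties
    (AbelianGroup.commutativeSemigroup abelianGroup) public
    using (interchange; x∙yz≈xz∙y; xy∙z≈xz∙y)
  open Lattice lattice public using (∧-cong; ∨-comm)
  open OrderLattice.IsLattice (LatticeProperties.∨-∧-isOrderTheoreticLattice lattice) public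
    using (x≤x∨y; y≤x∨y; ∨-least; x∧y≤x; x∧y≤y; ∧-greatest)
  open Poset poset public using (antisym; reflexive)
    renaming (refl to ≤-refl; trans to ≤-trans)
  open PosetReasoning poset

  +-mono : ∀ {w x y z} → w ≤ x → y ≤ z → w + y ≤ x + z
  +-mono w≤x y≤z = ≤-trans (+-monoˡ _ w≤x) (+-monoʳ _ y≤z)

  +-cancelʳ-≤ : ∀ z {x y} → x + z ≤ y + z → x ≤ y
  +-cancelʳ-≤ z {x} {y} p = begin
    x                ≈⟨ //-rightDividesʳ z x ⟨
    (x + z) + (- z)  ≤⟨ ≤+⇒-≤ p ⟩
    y                ∎

  x≤x+y : ∀ x {y} → id ≤ y → x ≤ x + y
  x≤x+y x {y} 0≤y = begin
    x       ≈⟨ identityʳ x ⟨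
    x + id  ≤⟨ +-monoʳ x 0≤y ⟩
    x + y   ∎

  x≤y+x : ∀ x {y} → id ≤ y → x ≤ y + x
  x≤y+x x {y} 0≤y = ≤-trans (x≤x+y x 0≤y) (reflexive (comm x y))

  double-nonneg⇒nonneg : ∀ h → id ≤ h + h → id ≤ h
  double-nonneg⇒nonneg h 0≤2h = begin
    id       ≈⟨ inverseˡ h ⟨
    - h + h  ≤⟨ +-monoˡ h (≤-trans (x≤x∨y _ _) h⁻≤id) ⟩
    id + h   ≈⟨ identityˡ h ⟩
    h        ∎
    where
    -h≤h : - h ≤ h
    -h≤h = begin
      - h       ≈⟨ identityˡ (- h) ⟨
      id + - h  ≤⟨ ≤+⇒-≤ 0≤2h ⟩
      h         ∎
    h⁻≤id : - h ∨ id ≤ id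
    -- `disjoint` is applied to the negative part itself: it lies below the positive part because
    -- `- h ≤ h`, and below itself by reflexivity.
    h⁻≤id = disjoint h (∨-least (≤-trans -h≤h (x≤x∨y h id)) (y≤x∨y h id)) ≤-refl

  -- The difference `k + - h` has a nonnegative double, since adding `h + h` to that double gives
  -- `k + k`.
  halve-≤ : ∀ {h k} → h + h ≤ k + k → h ≤ k
  halve-≤ {h} {k} 2h≤2k = begin
    h              ≈⟨ identityˡ h ⟨
    id + h         ≤⟨ +-monoˡ h (double-nonneg⇒nonneg (k + - h) 0≤2[k-h]) ⟩
    (k + - h) + h  ≈⟨ //-rightDividesˡ h k ⟩
    k              ∎
    where
    0≤2[k-h] : id ≤ (k + - h) + (k + - h)
    0≤2[k-h] = +-cancelʳ-≤ (h + h) (begin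
      id + (h + h)                         ≈⟨ identityˡ (h + h) ⟩
      h + h                                ≤⟨ 2h≤2k ⟩
      k + k                                ≈⟨ ∙-cong (//-rightDividesˡ h k) (//-rightDividesˡ h k) ⟨
      ((k + - h) + h) + ((k + - h) + h)    ≈⟨ interchange (k + - h) h (k + - h) h ⟩
      ((k + - h) + (k + - h)) + (h + h)    ∎)

  halve-≈ : ∀ {h k} → h + h ≈ k + k → h ≈ k
  halve-≈ 2h≈2k = antisym (halve-≤ (reflexive 2h≈2k)) (halve-≤ (reflexive (sym 2h≈2k)))

  x≤y⇒y∧x≈x : ∀ {x y} → x ≤ y → y ∧ x ≈ x
  x≤y⇒y∧x≈x x≤y = antisym (x∧y≤y _ _) (∧-greatest x≤y ≤-refl)

  x≤y⇒x∧y≈x : ∀ {x y} → x ≤ y → x ∧ y ≈ x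
  -- `x ≤ y` unfolds to `x ≈ x ∧ y`.
  x≤y⇒x∧y≈x x≤y = sym x≤y

  -- For the nontrivial bound, subtract `x` from `t`: the result lies below `v` because `id ≤ x`,
  -- and below `w`, hence below `v ∧ w`. This is the content of (C1).
  ∧-absorbs-truncation : ∀ v {x} w → id ≤ x → v ∧ (x + (v ∧ w)) ≈ v ∧ (x + w)
  ∧-absorbs-truncation v {x} w 0≤x = antisym
    (∧-greatest (x∧y≤x _ _) (≤-trans (x∧y≤y _ _) (+-monoʳ x (x∧y≤y v w))))
    (∧-greatest (x∧y≤x _ _) (begin
      t              ≤⟨ -≤⇒≤+ (∧-greatest
        (≤+⇒-≤ (≤-trans (x∧y≤x _ _) (x≤x+y v 0≤x)))
        (≤+⇒-≤ (≤-trans (x∧y≤y _ _) (reflexive (comm x w))))) ⟩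
      (v ∧ w) + x    ≈⟨ comm (v ∧ w) x ⟩
      x + (v ∧ w)    ∎))
    where
    t = v ∧ (x + w)

  x+[v-x]≈v : ∀ v x → x + (v + - x) ≈ v
  x+[v-x]≈v v x = trans (comm x (v + - x)) (//-rightDividesˡ x v)

  v-[v-x]≈x : ∀ v x → v + - (v + - x) ≈ x
  v-[v-x]≈x v x = trans (∙-congʳ (sym (x+[v-x]≈v v x))) (//-rightDividesʳ (v + - x) x)

  -- Adding `m` turns `q + y` into `v + y`, so each inequality is checked after adding `m`. The two
  -- upper bounds of `m` put `x` and `y` below `q + y`; conversely `(v + y) + - (x ∨ y)` lies below
  -- both arguments of the meet `m`.
  join-as-truncated-difference : ∀ v x y → (v + - (v ∧ ((v + - x) + y))) + y ≈ x ∨ y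
  join-as-truncated-difference v x y = antisym q+y≤x∨y (∨-least x≤q+y y≤q+y)
    where
    m = v ∧ ((v + - x) + y)
    q = v + - m
    [q+y]+m≈v+y : (q + y) + m ≈ v + y
    [q+y]+m≈v+y = trans (xy∙z≈xz∙y q y m) (∙-congʳ (//-rightDividesˡ m v))
    x≤q+y : x ≤ q + y
    x≤q+y = +-cancelʳ-≤ m (begin
      x + m                ≤⟨ +-monoʳ x (x∧y≤y _ _) ⟩
      x + ((v + - x) + y)  ≈⟨ assoc x (v + - x) y ⟨
      (x + (v + - x)) + y  ≈⟨ ∙-congʳ (x+[v-x]≈v v x) ⟩
      v + y                ≈⟨ [q+y]+m≈v+y ⟨
      (q + y) + m          ∎)
    y≤q+y : y ≤ q + y
    y≤q+y = +-cancelʳ-≤ m (begin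
      y + m        ≤⟨ +-monoʳ y (x∧y≤x _ _) ⟩
      y + v        ≈⟨ comm y v ⟩
      v + y        ≈⟨ [q+y]+m≈v+y ⟨
      (q + y) + m  ∎)
    v+y-x∨y≤m : (v + y) + - (x ∨ y) ≤ m
    v+y-x∨y≤m = ∧-greatest
      (≤+⇒-≤ (+-monoʳ v (y≤x∨y x y)))
      (≤+⇒-≤ (begin
        v + y                      ≈⟨ ∙-congʳ (//-rightDividesˡ x v) ⟨
        ((v + - x) + x) + y        ≈⟨ xy∙z≈xz∙y (v + - x) x y ⟩
        ((v + - x) + y) + x        ≤⟨ +-monoʳ _ (x≤x∨y x y) ⟩
        ((v + - x) + y) + (x ∨ y)  ∎))
    q+y≤x∨y : q + y ≤ x ∨ y
    q+y≤x∨y = +-cancelʳ-≤ m (begin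
      (q + y) + m  ≈⟨ [q+y]+m≈v+y ⟩
      v + y        ≤⟨ -≤⇒≤+ v+y-x∨y≤m ⟩
      m + (x ∨ y)  ≈⟨ comm m (x ∨ y) ⟩
      (x ∨ y) + m  ∎)

  -- The join stays below `v`, so the outer truncation is harmless. Commutativity of the join then
  -- yields (C6).
  truncated-join : ∀ {v x y} → x ≤ v → y ≤ v → v ∧ ((v + - (v ∧ ((v + - x) + y))) + y) ≈ x ∨ y
  truncated-join {v} {x} {y} x≤v y≤v =
    trans (∧-cong refl (join-as-truncated-difference v x y)) (x≤y⇒y∧x≈x (∨-least x≤v y≤v))

module Star {c ℓ} (G : LuGroup c ℓ) where
  open LuGroup G
  open LuGroupProperties G
  open PosetReasoning poset

  star-bounds : ∀ {g h} → id ≤ g → g ≤ u → h + h ≈ u + g → id ≤ h × h ≤ u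
  star-bounds {g} {h} 0≤g g≤u 2h≈u+g = double-nonneg⇒nonneg h 0≤2h , halve-≤ 2h≤2u
    where
    0≤2h : id ≤ h + h
    0≤2h = ≤-trans (+-nonneg id≤u 0≤g) (reflexive (sym 2h≈u+g))
    2h≤2u : h + h ≤ u + u
    2h≤2u = ≤-trans (reflexive 2h≈u+g) (+-monoʳ u g≤u)

  star-exists-unique : TwoDivisible G → ∃! (PointwiseEq G) (IsStar G)
  star-exists-unique half = star , isStar , λ isStar′ g →
    -- Any two candidate values at `g` have the same double `u + g`.
    halve-≈ (trans (isStar g) (sym (isStar′ g)))
    where
    star : Op₁ [id,u]
    star (g , 0≤g , g≤u) = proj₁ (half (u + g)) , star-bounds 0≤g g≤u (sym (proj₂ (half (u + g))))
    isStar : IsStar G star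
    isStar (g , _) = sym (proj₂ (half (u + g)))

  -- In `Γ`, `¬ 0̄` unfolds to `u + - id`; this bridges the gap in (C5) and (C8).
  u≈¬0 : u ≈ u + - id
  u≈¬0 = sym (trans (∙-congˡ ε⁻¹≈ε) (identityʳ u))

  module _ (_* : Op₁ [id,u]) (isStar : IsStar G _*) where

    κ≈x+¬κ : ∀ x → proj₁ (x *) ≈ proj₁ x + (u + - proj₁ (x *))
    κ≈x+¬κ x = begin-equality
      s                ≈⟨ //-rightDividesʳ s s ⟨
      (s + s) + - s    ≈⟨ ∙-congʳ (isStar x) ⟩
      (u + g) + - s    ≈⟨ ∙-congʳ (comm u g) ⟩
      (g + u) + - s    ≈⟨ assoc g u (- s) ⟩
      g + (u + - s)    ∎
      where
      g = proj₁ x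
      s = proj₁ (x *)

    κ-difference-bound : ∀ x y {p} → id ≤ p → proj₁ x ≤ p + proj₁ y →
                         proj₁ (x *) ≤ p + proj₁ (y *)
    κ-difference-bound x y {p} 0≤p x≤p+y = halve-≤ (begin
      s + s                    ≈⟨ isStar x ⟩
      -- One copy of `p` enlarges `u` and the other comes from the bound on `x`, so that the right
      -- side becomes a double.
      u + proj₁ x              ≤⟨ +-mono (x≤y+x u 0≤p) x≤p+y ⟩
      (p + u) + (p + proj₁ y)  ≈⟨ interchange p u p (proj₁ y) ⟩
      (p + p) + (u + proj₁ y)  ≈⟨ ∙-congˡ (isStar y) ⟨
      (p + p) + (t + t)        ≈⟨ interchange p p t t ⟩
      (p + t) + (p + t)        ∎)
      where
      s = proj₁ (x *)
      t = proj₁ (y *)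

    -- Moving `p` to the left leaves `u + - p` to be bounded by both arguments of the first meet: by
    -- `u` since `id ≤ p`, and by `(u + - s) + t` since `s ≤ p + t`.
    C8-bound : ∀ x y → let s = proj₁ (x *) ; t = proj₁ (y *) in
      u ≤ (u ∧ ((u + - s) + t)) + (u + - (u ∧ ((u + - proj₁ x) + proj₁ y)))
    C8-bound x y = -≤⇒≤+ (∧-greatest (≤+⇒-≤ (x≤x+y u 0≤p)) (≤+⇒-≤ (begin
      u                    ≈⟨ //-rightDividesˡ s u ⟨
      (u + - s) + s        ≤⟨ +-monoʳ _ (κ-difference-bound x y 0≤p x≤p+y) ⟩
      (u + - s) + (p + t)  ≈⟨ x∙yz≈xz∙y (u + - s) p t ⟩
      ((u + - s) + t) + p  ∎)))
      where
      s = proj₁ (x *)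
      t = proj₁ (y *)
      p = u + - (u ∧ ((u + - proj₁ x) + proj₁ y))
      0≤p : id ≤ p
      0≤p = ≤⇒0≤- (x∧y≤x _ _)
      x≤p+y : proj₁ x ≤ p + proj₁ y
      x≤p+y = ≤-trans (x≤x∨y _ _) (reflexive (sym (join-as-truncated-difference u (proj₁ x) (proj₁ y))))

    Γ-isContinuousAlgebra : IsContinuousAlgebra (Γ G _*)
    Γ-isContinuousAlgebra = record
      { isEquivalence = record { refl = refl ; sym = sym ; trans = trans }
      ; ⊕-cong = λ x≈x′ y≈y′ → ∧-cong refl (∙-cong x≈x′ y≈y′)
      ; ¬-cong = λ x≈x′ → ∙-congˡ (⁻¹-cong x≈x′)
      ; κ-cong = λ {x} {y} x≈y → halve-≈ (trans (isStar x) (trans (∙-congˡ x≈y) (sym (isStar y))))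
      ; C1 = λ (x , 0≤x , _) (y , _) (z , 0≤z , _) → begin-equality
          u ∧ (x + (u ∧ (y + z)))  ≈⟨ ∧-absorbs-truncation u (y + z) 0≤x ⟩
          -- Commutativity brings `z` to the left, so that the same absorption lemma serves the
          -- other bracketing.
          u ∧ (x + (y + z))        ≈⟨ ∧-cong refl (trans (sym (assoc x y z)) (comm (x + y) z)) ⟩
          u ∧ (z + (x + y))        ≈⟨ ∧-absorbs-truncation u (x + y) 0≤z ⟨
          u ∧ (z + (u ∧ (x + y)))  ≈⟨ ∧-cong refl (comm z _) ⟩
          u ∧ ((u ∧ (x + y)) + z)  ∎
      ; C2 = λ (x , _) (y , _) → ∧-cong refl (comm x y)
      ; C3 = λ (x , _ , x≤u) → trans (∧-cong refl (identityʳ x)) (x≤y⇒y∧x≈x x≤u)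
      ; C4 = λ (x , _) → v-[v-x]≈x u x
      ; C5 = λ (x , 0≤x , _) →
          trans (x≤y⇒x∧y≈x (≤-trans (x≤y+x u 0≤x) (reflexive (∙-congˡ u≈¬0)))) u≈¬0
      ; C6 = λ (x , _ , x≤u) (y , _ , y≤u) →
          trans (truncated-join x≤u y≤u) (trans (∨-comm x y) (sym (truncated-join y≤u x≤u)))
      -- The sum inside the truncation is already `x *`, which lies below `u`.
      ; C7 = λ x → sym (trans (∧-cong refl (sym (κ≈x+¬κ x))) (x≤y⇒y∧x≈x (proj₂ (proj₂ (x *)))))
      ; C8 = λ x y → trans (x≤y⇒x∧y≈x (C8-bound x y)) u≈¬0
      }

theorem4p2 : {c ℓ : Level} (G : LuGroup c ℓ) → TwoDivisible G →
    ∃! (PointwiseEq G) (IsStar G) ×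
    ((_* : Op₁ (LuGroup.[id,u] G)) → IsStar G _* → IsContinuousAlgebra (Γ G _*))
theorem4p2 G half = star-exists-unique half , Γ-isContinuousAlgebra
  where open Star G
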